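{- For any finite, simple, connected, undirected graphs $G$ and $H$, $$\gamma(G\,\square\, H)\geq \frac{\pi(G)}{2\pi(G)-1}\,\gamma(G)\,\gamma(H).$$
   Context: All graphs are finite, simple, connected and undirected (with nonempty vertex set). For a graph $G$ and $v\in V(G)$, $N[v]$ denotes the closed neighborhood of $v$ (that is, $v$ together with all its neighbors), and $N[S]=\bigcup_{v\in S}N[v]$ for $S\subseteq V(G)$. A set $S\subseteq V(G)$ dominates $G$ if $N[S]=V(G)$. The domination number $\gamma(G)$ is the minimum cardinality of a set that dominates $G$; a dominating set of cardinality $\gamma(G)$ is called a $\gamma$-set of $G$. The Cartesian product $G\,\square\,H$ is the graph with vertex set $V(G)\times V(H)$ in which $(u_1,v_1)$ and $(u_2,v_2)$ are adjacent if and only if either $v_1=v_2$ and $u_1u_2\in E(G)$, or $u_1=u_2$ and $v_1v_2\in E(H)$. For a $\gamma$-set $D$ of $G$, the allegiance of $D$ with respect to $G$ is $a_G(D)=\max_{v\in V(G)}|D\cap N[v]|$. The power of $G$ is $\pi(G)=\min_D a_G(D)$, where the minimum is taken over all $\gamma$-sets $D$ of $G$. -}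

module Defs where

open import Data.Bool.Properties using () renaming (_≟_ to _≟ᵇ_)
open import Data.Fin.Base using (Fin; zero; remQuot)
open import Data.Fin.Properties using (_≟_)
open import Data.Fin.Subset using (Subset; inside; outside; _∈_; _∩_; ⊤; ⋃; ∣_∣)
open import Data.Fin.Subset.Properties
  using (_∈?_; ∈⊤; ∉⊥; x∈p∩q⁺; x∈p⇒∣p-x∣<∣p∣)
open import Data.List.Base as List using (List; []; _∷_; _++_; filter; allFin)
open import Data.List.Extrema.Nat using (min; max; v≤min⁺; v≤max⁺)
open import Data.List.Membership.Propositional as ListMem using (lose)
open import Data.List.Membership.Propositional.Properties using (∈-allFin; ∈-filter⁻)
open import Data.List.Relation.Unary.All as All using ()
open import Data.List.Relation.Unary.All.Properties as Allₚ using (all-filter)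
open import Data.List.Relation.Unary.Any using (here)
open import Data.List.Relation.Unary.Any.Properties as Anyₚ using ()
open import Data.Nat.Base
  using (ℕ; zero; suc; _*_; _∸_; _≤_; z≤n; s≤s; NonZero; >-nonZero; >-nonZero⁻¹)
open import Data.Nat.Properties as ℕₚ using ()
open import Data.Product.Base using (∃; _×_; _,_; proj₁; proj₂)
open import Data.Sum.Base as Sum using (_⊎_; inj₁; inj₂)
open import Data.Vec.Base as Vec using (tabulate)
open import Data.Vec.Properties using (≡-dec; lookup∘tabulate; lookup⇒[]=)
open import Function.Base using (_on_; _∘_)
open import Level using (0ℓ)
open import Relation.Binary.Construct.Closure.ReflexiveTransitive using (Star)
open import Relation.Binary.Core using (Rel)
open import Relation.Binary.Definitions using (Decidable; Symmetric)
open import Relation.Binary.PropositionalEquality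
  using (_≡_; refl; sym; trans; subst)
open import Relation.Nullary using (¬_; Dec; does; contradiction)
open import Relation.Nullary.Decidable using (dec-true; _×-dec_; _⊎-dec_)

-- Finite simple graphs with vertex set Fin n.  Connectedness (Connected, below)
-- and nonemptiness (NonZero n) are kept as separate hypotheses.

record Graph (n : ℕ) : Set₁ where
  infix 4 _~_ _~?_
  field
    _~_     : Rel (Fin n) 0ℓ
    _~?_    : Decidable _~_
    ~-sym   : Symmetric _~_
    ~-irref : ∀ {v} → ¬ (v ~ v)

Connected : ∀ {n} → Graph n → Set
Connected G = ∀ u v → Star (Graph._~_ G) u v

-- The vertex (u , v) of the product is represented by combine u v : Fin (m * n);
-- remQuot n is the inverse bijection Fin (m * n) → Fin m × Fin n.

module _ {m n : ℕ} (G : Graph m) (H : Graph n) where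
  private
    module G = Graph G
    module H = Graph H

  CartesianAdj : Rel (Fin m × Fin n) 0ℓ
  CartesianAdj (u₁ , v₁) (u₂ , v₂) = (v₁ ≡ v₂ × u₁ G.~ u₂) ⊎ (u₁ ≡ u₂ × v₁ H.~ v₂)

  infixr 7 _□_
  _□_ : Graph (m * n)
  _□_ = record
    { _~_     = CartesianAdj on remQuot n
    ; _~?_    = λ x y → adj? (remQuot n x) (remQuot n y)
    ; ~-sym   = Sum.map (λ (p , q) → sym p , G.~-sym q) (λ (p , q) → sym p , H.~-sym q)
    ; ~-irref = Sum.[ G.~-irref ∘ proj₂ , H.~-irref ∘ proj₂ ]
    }
    where
    adj? : Decidable CartesianAdj
    adj? (u₁ , v₁) (u₂ , v₂) =
      (v₁ ≟ v₂ ×-dec u₁ G.~? u₂) ⊎-dec (u₁ ≟ u₂ ×-dec v₁ H.~? v₂)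

subsets : ∀ n → List (Subset n)
subsets zero    = Vec.[] ∷ []
subsets (suc n) = List.map (outside Vec.∷_) (subsets n)
               ++ List.map (inside  Vec.∷_) (subsets n)

module _ {n : ℕ} (G : Graph n) where
  open Graph G

  N[_] : Fin n → Subset n
  N[ v ] = tabulate λ u → does (u ≟ v ⊎-dec v ~? u)

  N[_]ˢ : Subset n → Subset n
  N[ S ]ˢ = ⋃ (List.map N[_] (filter (_∈? S) (allFin n)))

  Dominates : Subset n → Set
  Dominates S = N[ S ]ˢ ≡ ⊤

  dominates? : ∀ S → Dec (Dominates S)
  dominates? S = ≡-dec _≟ᵇ_ N[ S ]ˢ ⊤

  -- The first argument of min is included in the minimum.  Here it is n = ∣ ⊤ ∣,
  -- the size of a set that always dominates, so it does not affect the value.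

  γ : ℕ
  γ = min n (List.map ∣_∣ (filter dominates? (subsets n)))

  IsγSet : Subset n → Set
  IsγSet D = Dominates D × ∣ D ∣ ≡ γ

  isγSet? : ∀ D → Dec (IsγSet D)
  isγSet? D = dominates? D ×-dec ∣ D ∣ ℕₚ.≟ γ

  allegiance : Subset n → ℕ
  allegiance D = max 0 (List.map (λ v → ∣ D ∩ N[ v ] ∣) (allFin n))

  -- Again the first argument of min is harmless: γ-sets exist, and every
  -- allegiance is at most n.

  π : ℕ
  π = min n (List.map allegiance (filter isγSet? (subsets n)))

-- For a nonempty graph π G ≥ 1, so 2 * π G ∸ 1 is not truncated and is a valid
-- denominator.

module _ {n : ℕ} .{{_ : NonZero n}} (G : Graph n) where

  private
    v∈N[v] : ∀ v → v ∈ N[_] G v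
    v∈N[v] v = lookup⇒[]= v _ (trans (lookup∘tabulate _ v)
      (dec-true (v ≟ v ⊎-dec Graph._~?_ G v v) (inj₁ refl)))

    vertex : ∀ {k} → .{{NonZero k}} → Fin k
    vertex {suc _} = zero

    dominating⇒nonempty : ∀ S → Dominates G S → ∃ λ v → v ∈ S
    dominating⇒nonempty S dom
      with filter (_∈? S) (allFin n) in eq
    ... | []    = contradiction (subst (vertex ∈_) (sym dom) ∈⊤) ∉⊥
    ... | v ∷ _ = v , proj₂ (∈-filter⁻ (_∈? S) {xs = allFin n}
                    (subst (v ListMem.∈_) (sym eq) (here refl)))

    1≤allegiance : ∀ S → Dominates G S → 1 ≤ allegiance G S
    1≤allegiance S dom =
      let v , v∈S = dominating⇒nonempty S dom in
      v≤max⁺ 0 _ (inj₂ (Anyₚ.map⁺ (lose (∈-allFin v)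
        (ℕₚ.≤-trans (s≤s z≤n) (x∈p⇒∣p-x∣<∣p∣ (x∈p∩q⁺ (v∈S , v∈N[v] v)))))))

  1≤π : 1 ≤ π G
  1≤π = v≤min⁺ (>-nonZero⁻¹ n)
    (Allₚ.map⁺ (All.map (λ {D} γ-set → 1≤allegiance D (proj₁ γ-set))
      (all-filter (isγSet? G) (subsets n))))

  2π∸1-nonZero : NonZero (2 * π G ∸ 1)
  2π∸1-nonZero = >-nonZero (ℕₚ.∸-monoˡ-≤ 1 (ℕₚ.*-monoʳ-≤ 2 1≤π))

-- Fix a γ-set Γ of G with allegiance p = π(G) and a γ-set D of the product, and
-- colour every row h of the product with one of p colours.  The colour of its row
-- makes each (g , h) ∈ D choose a label in Γ ∩ N[g]: g itself if g ∈ Γ, and otherwise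
-- every element of Γ ∩ N[g] is chosen for some colour.  Call u ∈ Γ uncovered in row h
-- if no row h′ ∈ N[h] uses the label u.  For each u ∈ Γ the rows using u and the rows
-- where u is uncovered together dominate H, so γ(G) γ(H) is at most |D| plus the
-- number of uncovered pairs.  When only the colour of row h varies, the uncovered
-- pairs in that row number on average at most (1 - 1/p) |D ∩ (G × {h})|; averaging over
-- all colourings gives γ(G) γ(H) ≤ (2 - 1/p) |D|.

module Submission where

open import Data.Bool.Base using (if_then_else_)
open import Data.Fin.Base using (Fin; zero; suc; combine; _↑ˡ_; _↑ʳ_)
open import Data.Fin.Properties using (_≟_; any?; remQuot-combine; combine-surjective)
open import Data.Fin.Subset using (Subset; inside; outside; _∈_; _∉_; _∩_; ⊤; ⋃; ∣_∣; ⁅_⁆; _-_)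
open import Data.Fin.Subset.Properties
  using (_∈?_; ∈⊤; ⊆⊤; ∉⊥; x∈p∩q⁺; x∈p∩q⁻; x∈p∪q⁺; x∈p∪q⁻; ⊆-antisym; ∣⁅x⁆∣≡1; x∈⁅x⁆; x∈⁅y⁆⇒x≡y;
         ∣p∣≤n; nonempty?; x∈p⇒∣p-x∣<∣p∣; x∈p∧x≢y⇒x∈p-y; p─q⊆p)
import Data.Integer.Base as ℤ
import Data.Integer.Properties as ℤₚ
open import Data.List.Base as List using ([]; _∷_; filter; allFin)
open import Data.List.Extrema.Nat using (min; argmin-sel; min≤v⁺; max≤v⁺; xs≤max)
import Data.List.Membership.Propositional as ListMem
open import Data.List.Membership.Propositional.Properties
  using (∈-allFin; ∈-filter⁺; ∈-filter⁻; ∈-map⁺; ∈-map⁻; ∈-++⁺ˡ; ∈-++⁺ʳ)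
open import Data.List.Relation.Unary.All as All using ()
import Data.List.Relation.Unary.All.Properties as Allₚ
open import Data.List.Relation.Unary.Any as Any using (Any; here; there)
import Data.List.Relation.Unary.Any.Properties as Anyₚ
open import Data.Nat.Base using (ℕ; zero; suc; NonZero; _∸_; _+_; _^_; _≤_; z≤n; s≤s; s≤s⁻¹) renaming (_*_ to _*ℕ_)
open import Data.Nat.Properties as ℕₚ using (+-*-semiring; ≤-refl; ≤-trans; ≤-reflexive; +-mono-≤)
open import Data.Nat.Tactic.RingSolver using (solve-∀)
open import Data.Product.Base using (∃; Σ-syntax; _×_; _,_; proj₁; proj₂)
open import Data.Rational.Base using (_/_; _*_; _≥_)
open import Data.Rational.Properties using (toℚᵘ-cancel-≤; toℚᵘ-homo-*; toℚᵘ-fromℚᵘ)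
import Data.Rational.Base as ℚ
import Data.Rational.Unnormalised.Base as ℚᵘ
import Data.Rational.Unnormalised.Properties as ℚᵘₚ
open import Data.Sum.Base as Sum using (_⊎_; inj₁; inj₂)
open import Data.Vec.Base as Vec using (Vec; tabulate; lookup; _[_]≔_)
open import Data.Vec.Properties using (lookup∘tabulate; lookup⇒[]=; []=⇒lookup; lookup∘update; lookup∘update′)
open import Function.Base using (_∘_; _$_)
open import Relation.Binary.PropositionalEquality
open import Relation.Nullary using (¬_; Dec; yes; no; does; contradiction; ¬?)
open import Relation.Nullary.Decidable using (dec-true; _×-dec_; _⊎-dec_)
open import Algebra.Properties.Semiring.Sum +-*-semiring
open import Defs

private
  variable
    m n k : ℕ
    P Q : Set

-- Finite sums, indicators and subsets

sum-mono-≤ : {f g : Fin n → ℕ} → (∀ i → f i ≤ g i) → sum f ≤ sum g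
sum-mono-≤ {zero}  f≤g = z≤n
sum-mono-≤ {suc n} f≤g = +-mono-≤ (f≤g zero) (sum-mono-≤ (f≤g ∘ suc))

sum-const : ∀ n x → ∑[ i < n ] x ≡ n *ℕ x
sum-const zero    x = refl
sum-const (suc n) x = cong (x +_) (sum-const n x)

sum-↑ : ∀ m {n} (f : Fin (m + n) → ℕ) → sum f ≡ ∑[ i < m ] f (i ↑ˡ n) + ∑[ j < n ] f (m ↑ʳ j)
sum-↑ zero    f = refl
sum-↑ (suc m) f = trans (cong (f zero +_) (sum-↑ m (f ∘ suc))) (sym (ℕₚ.+-assoc (f zero) _ _))

sum-combine : ∀ m n (f : Fin (m *ℕ n) → ℕ) → sum f ≡ ∑[ i < m ] ∑[ j < n ] f (combine i j)
sum-combine zero    n f = refl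
sum-combine (suc m) n f = trans (sum-↑ n f) (cong₂ _+_ refl (sum-combine m n (f ∘ (n ↑ʳ_))))

term≤sum : (f : Fin n → ℕ) (i : Fin n) → f i ≤ sum f
term≤sum {suc n} f i = ≤-trans (ℕₚ.m≤m+n (f i) _) (≤-reflexive (sym (sum-remove f)))

𝟙 : Dec P → ℕ
𝟙 P? = if does P? then 1 else 0

𝟙≤1 : (P? : Dec P) → 𝟙 P? ≤ 1
𝟙≤1 (yes _) = ≤-refl
𝟙≤1 (no _)  = z≤n

𝟙-true : (P? : Dec P) → P → 𝟙 P? ≡ 1
𝟙-true (yes _) p = refl
𝟙-true (no ¬p) p = contradiction p ¬p

𝟙-mono : (P? : Dec P) (Q? : Dec Q) → (P → Q) → 𝟙 P? ≤ 𝟙 Q?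
𝟙-mono (no _)  Q? f = z≤n
𝟙-mono (yes p) Q? f = ≤-reflexive (sym (𝟙-true Q? (f p)))

𝟙-⊎ : (P? : Dec P) (Q? : Dec Q) → 𝟙 (P? ⊎-dec Q?) ≤ 𝟙 P? + 𝟙 Q?
𝟙-⊎ (yes _) Q? = s≤s z≤n
𝟙-⊎ (no _)  (yes _) = ≤-refl
𝟙-⊎ (no _)  (no _) = ≤-refl

𝟙-× : (P? : Dec P) (Q? : Dec Q) → 𝟙 (P? ×-dec Q?) ≡ 𝟙 P? *ℕ 𝟙 Q?
𝟙-× (yes _) (yes _) = refl
𝟙-× (yes _) (no _)  = refl
𝟙-× (no _)  Q?      = refl

𝟙-split : (P? : Dec P) (Q? : Dec Q) → 𝟙 P? ≡ 𝟙 (P? ×-dec ¬? Q?) + 𝟙 (P? ×-dec Q?)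
𝟙-split (yes _) (yes _) = refl
𝟙-split (yes _) (no _)  = refl
𝟙-split (no _)  (yes _) = refl
𝟙-split (no _)  (no _)  = refl

-- The two events on the left are disjoint with union `P ⊎ Q`, and so are the two on the right. It
-- is applied with `P` membership in a row of `D`, `Q` membership in `Γ` and `R` coverage from other
-- rows.
𝟙-exchange : {R : Set} (P? : Dec P) (Q? : Dec Q) (R? : Dec R) →
  𝟙 (P? ⊎-dec (Q? ×-dec R?)) + 𝟙 (Q? ×-dec ¬? R? ×-dec ¬? P?) ≤ 𝟙 Q? + 𝟙 (P? ×-dec ¬? Q?)
𝟙-exchange (yes _) (yes _) (yes _) = ≤-refl
𝟙-exchange (yes _) (yes _) (no _)  = ≤-refl
𝟙-exchange (yes _) (no _)  R?      = ≤-refl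
𝟙-exchange (no _)  (yes _) (yes _) = ≤-refl
𝟙-exchange (no _)  (yes _) (no _)  = ≤-refl
𝟙-exchange (no _)  (no _)  R?      = ≤-refl

𝟙≤sum : {Q : Fin n → Set} (P? : Dec P) (Q? : ∀ i → Dec (Q i)) → (P → ∃ Q) → 𝟙 P? ≤ ∑[ i < n ] 𝟙 (Q? i)
𝟙≤sum (no _)  Q? f = z≤n
𝟙≤sum (yes p) Q? f with i , q ← f p = ≤-trans (≤-reflexive (sym (𝟙-true (Q? i) q))) (term≤sum (𝟙 ∘ Q?) i)

sum-𝟙≤ : {P : Fin n → Set} (P? : ∀ i → Dec (P i)) → ∑[ i < n ] 𝟙 (P? i) ≤ n
sum-𝟙≤ {n} P? = ≤-trans (sum-mono-≤ (𝟙≤1 ∘ P?)) (≤-reflexive (trans (sum-const n 1) (ℕₚ.*-identityʳ n)))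

sum-𝟙< : {P : Fin (suc n) → Set} (P? : ∀ i → Dec (P i)) → ∀ i → ¬ P i → sum (𝟙 ∘ P?) ≤ n
sum-𝟙< P? i ¬p = ≤-trans (≤-reflexive (sum-remove {i = i} (𝟙 ∘ P?)))
  (+-mono-≤ (𝟙-mono (P? i) (no ¬p) (λ p → p)) (sum-𝟙≤ (P? ∘ _)))

sum-𝟙-× : {Q : Fin n → Set} (P? : Dec P) (Q? : ∀ i → Dec (Q i)) →
  ∑[ i < n ] 𝟙 (P? ×-dec Q? i) ≡ 𝟙 P? *ℕ ∑[ i < n ] 𝟙 (Q? i)
sum-𝟙-× P? Q? = trans (sum-cong-≗ (𝟙-× P? ∘ Q?)) (sym (*-distribˡ-sum (𝟙 P?) (𝟙 ∘ Q?)))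

-- When `P?` decides nearness to `v`, this unfolds to the same `tabulate` as `N[ v ]`, so the two
-- membership lemmas below apply to closed neighbourhoods as they stand.
select : {P : Fin n → Set} → (∀ i → Dec (P i)) → Subset n
select P? = tabulate (does ∘ P?)

module _ {P : Fin n → Set} (P? : ∀ i → Dec (P i)) where

  ∈-select⁺ : ∀ {i} → P i → i ∈ select P?
  ∈-select⁺ {i} p = lookup⇒[]= i _ (trans (lookup∘tabulate _ i) (dec-true (P? i) p))

  ∈-select⁻ : ∀ {i} → i ∈ select P? → P i
  ∈-select⁻ {i} i∈ with P? i | trans (sym (lookup∘tabulate (does ∘ P?) i)) ([]=⇒lookup i∈)
  ... | yes p | _ = p

∣select∣ : {P : Fin n → Set} (P? : ∀ i → Dec (P i)) → ∣ select P? ∣ ≡ ∑[ i < n ] 𝟙 (P? i)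
∣select∣ {zero}  P? = refl
∣select∣ {suc n} P? with P? zero
... | yes _ = cong suc (∣select∣ (P? ∘ suc))
... | no _  = ∣select∣ (P? ∘ suc)

∣_∣≡sum : (S : Subset n) → ∣ S ∣ ≡ ∑[ i < n ] 𝟙 (i ∈? S)
∣ S ∣≡sum = trans (cong ∣_∣ (⊆-antisym (∈-select⁺ (_∈? S)) (∈-select⁻ (_∈? S)))) (∣select∣ (_∈? S))

sum-singleton : (i : Fin n) → ∑[ j < n ] 𝟙 (j ∈? ⁅ i ⁆) ≡ 1
sum-singleton i = trans (sym ∣ ⁅ i ⁆ ∣≡sum) (∣⁅x⁆∣≡1 i)

-- Induction on `k`, splitting off `x`. Repetitions are allowed, so `k` may exceed `∣ S ∣`: the last
-- element left fills all remaining positions, which is why `S` has to be inhabited.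
enumerate : ∀ k (S : Subset n) → ∣ S ∣ ≤ k → ∀ {x} → x ∈ S →
  Σ[ f ∈ (Fin k → Fin n) ] (∀ c → f c ∈ S) × (∀ {y} → y ∈ S → ∃ λ c → f c ≡ y)
enumerate zero    S ∣S∣≤k x∈S = contradiction (ℕₚ.<-≤-trans (x∈p⇒∣p-x∣<∣p∣ x∈S) ∣S∣≤k) λ ()
enumerate (suc k) S ∣S∣≤k {x} x∈S with nonempty? (S - x)
... | no empty = (λ _ → x) , (λ _ → x∈S) , onto
  where
  onto : ∀ {y} → y ∈ S → ∃ λ _ → x ≡ y
  onto {y} y∈S with y ≟ x
  ... | yes y≡x = zero , sym y≡x
  ... | no y≢x  = contradiction (y , x∈p∧x≢y⇒x∈p-y y∈S y≢x) empty
... | yes (z , z∈S-x)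
  with f , f∈ , f-onto ← enumerate k (S - x) (s≤s⁻¹ (ℕₚ.<-≤-trans (x∈p⇒∣p-x∣<∣p∣ x∈S) ∣S∣≤k)) z∈S-x
  = f′ , f′∈ , onto
  where
  f′ : Fin (suc k) → _
  f′ zero    = x
  f′ (suc c) = f c

  f′∈ : ∀ c → f′ c ∈ S
  f′∈ zero    = x∈S
  f′∈ (suc c) = p─q⊆p S ⁅ x ⁆ (f∈ c)

  onto : ∀ {y} → y ∈ S → ∃ λ c → f′ c ≡ y
  onto {y} y∈S with y ≟ x
  ... | yes y≡x = zero , sym y≡x
  ... | no y≢x  = let c , eq = f-onto (x∈p∧x≢y⇒x∈p-y y∈S y≢x) in suc c , eq

-- Averaging over colourings

sumVec : ∀ n → (Vec (Fin k) n → ℕ) → ℕ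
sumVec zero    F = F Vec.[]
sumVec (suc n) F = sum λ c → sumVec n (F ∘ (c Vec.∷_))

sumVec-mono-≤ : ∀ n {F F′ : Vec (Fin k) n → ℕ} → (∀ κ → F κ ≤ F′ κ) → sumVec n F ≤ sumVec n F′
sumVec-mono-≤ zero    F≤F′ = F≤F′ Vec.[]
sumVec-mono-≤ (suc n) F≤F′ = sum-mono-≤ λ c → sumVec-mono-≤ n (F≤F′ ∘ (c Vec.∷_))

sumVec-+ : ∀ n (F F′ : Vec (Fin k) n → ℕ) → sumVec n (λ κ → F κ + F′ κ) ≡ sumVec n F + sumVec n F′
sumVec-+ zero    F F′ = refl
sumVec-+ (suc n) F F′ =
  trans (sum-cong-≗ λ c → sumVec-+ n (F ∘ (c Vec.∷_)) (F′ ∘ (c Vec.∷_)))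
        (∑-distrib-+ (λ c → sumVec n (F ∘ (c Vec.∷_))) (λ c → sumVec n (F′ ∘ (c Vec.∷_))))

sumVec-const : ∀ n x → sumVec {k} n (λ _ → x) ≡ k ^ n *ℕ x
sumVec-const     zero    x = sym (ℕₚ.+-identityʳ x)
sumVec-const {k} (suc n) x = begin
  sum {k} (λ _ → sumVec {k} n (λ _ → x))  ≡⟨ sum-const k (sumVec {k} n (λ _ → x)) ⟩
  k *ℕ sumVec {k} n (λ _ → x)             ≡⟨ cong (k *ℕ_) (sumVec-const n x) ⟩
  k *ℕ (k ^ n *ℕ x)           ≡⟨ ℕₚ.*-assoc k _ x ⟨
  k ^ suc n *ℕ x              ∎
  where open ≡-Reasoning

sumVec-sum : ∀ n (F : Fin m → Vec (Fin k) n → ℕ) →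
  sumVec n (λ κ → ∑[ i < m ] F i κ) ≡ ∑[ i < m ] sumVec n (F i)
sumVec-sum zero    F = refl
sumVec-sum (suc n) F =
  trans (sum-cong-≗ λ c → sumVec-sum n λ i → F i ∘ (c Vec.∷_)) (∑-comm λ c i → sumVec n (F i ∘ (c Vec.∷_)))

-- Each colouring arises as `κ [ h ]≔ c` from exactly `k` pairs of `κ` and `c`, because the old
-- colour at `h` is forgotten. Recolouring one row uniformly thus preserves averages.
sumVec-resample : ∀ n (h : Fin n) (F : Vec (Fin k) n → ℕ) →
  sumVec n (λ κ → ∑[ c < k ] F (κ [ h ]≔ c)) ≡ k *ℕ sumVec n F
sumVec-resample {k} (suc n) zero F =
  trans (sum-const k _) (cong (k *ℕ_) (sumVec-sum n λ c → F ∘ (c Vec.∷_)))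
sumVec-resample {k} (suc n) (suc h) F =
  trans (sum-cong-≗ λ c → sumVec-resample n h (F ∘ (c Vec.∷_))) (sym (*-distribˡ-sum k (λ c → sumVec n (F ∘ (c Vec.∷_)))))

-- Sum the second hypothesis over all `N` colourings. By `sumVec-resample`, `suc q` times the total
-- of `W h` equals its total over resampled colourings, which is at most `N *ℕ b h`; then cancel
-- `N`.
average : ∀ q n (W : Fin n → Vec (Fin (suc q)) n → ℕ) (b : Fin n → ℕ) {x y} →
  (∀ h κ → ∑[ c < suc q ] W h (κ [ h ]≔ c) ≤ b h) →
  (∀ κ → x ≤ y + ∑[ h < n ] W h κ) →
  suc q *ℕ x ≤ suc q *ℕ y + sum b
average q n W b {x} {y} W≤b x≤ = ℕₚ.*-cancelˡ-≤ N {{ℕₚ.m^n≢0 p n}} $ begin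
  N *ℕ (p *ℕ x)                                                       ≡⟨ swap N p x ⟩
  p *ℕ (N *ℕ x)                                                       ≡⟨ cong (p *ℕ_) (sumVec-const n x) ⟨
  p *ℕ sumVec n (λ _ → x)                                             ≤⟨ ℕₚ.*-monoʳ-≤ p (sumVec-mono-≤ n x≤) ⟩
  p *ℕ sumVec n (λ κ → y + sum (λ h → W h κ))                         ≡⟨ cong (p *ℕ_) (sumVec-+ n _ _) ⟩
  p *ℕ (sumVec n (λ _ → y) + sumVec n (λ κ → sum (λ h → W h κ)))      ≡⟨ cong (p *ℕ_) (cong₂ _+_ (sumVec-const n y) (sumVec-sum n W)) ⟩
  p *ℕ (N *ℕ y + sum (λ h → sumVec n (W h)))                          ≡⟨ ℕₚ.*-distribˡ-+ p (N *ℕ y) _ ⟩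
  p *ℕ (N *ℕ y) + p *ℕ sum (λ h → sumVec n (W h))                     ≡⟨ cong₂ _+_ (swap p N y) (*-distribˡ-sum p (λ h → sumVec n (W h))) ⟩
  N *ℕ (p *ℕ y) + sum (λ h → p *ℕ sumVec n (W h))                     ≡⟨ cong (N *ℕ (p *ℕ y) +_) (sum-cong-≗ λ h → sumVec-resample n h (W h)) ⟨
  N *ℕ (p *ℕ y) + sum (λ h → sumVec n (λ κ → sum λ c → W h (κ [ h ]≔ c)))
    ≤⟨ ℕₚ.+-monoʳ-≤ (N *ℕ (p *ℕ y)) (sum-mono-≤ λ h → sumVec-mono-≤ n (W≤b h)) ⟩
  N *ℕ (p *ℕ y) + sum (λ h → sumVec {p} n (λ _ → b h))                ≡⟨ cong (N *ℕ (p *ℕ y) +_) (sum-cong-≗ λ h → sumVec-const n (b h)) ⟩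
  N *ℕ (p *ℕ y) + sum (λ h → N *ℕ b h)                                ≡⟨ cong (N *ℕ (p *ℕ y) +_) (*-distribˡ-sum N b) ⟨
  N *ℕ (p *ℕ y) + N *ℕ sum b                                          ≡⟨ ℕₚ.*-distribˡ-+ N _ _ ⟨
  N *ℕ (p *ℕ y + sum b)                                               ∎
  where
  open ℕₚ.≤-Reasoning
  p = suc q
  N = p ^ n

  swap : ∀ x y z → x *ℕ (y *ℕ z) ≡ y *ℕ (x *ℕ z)
  swap = solve-∀

-- Domination

∈-⋃⁺ : ∀ {x : Fin n} {Ss} → Any (x ∈_) Ss → x ∈ ⋃ Ss
∈-⋃⁺ (here x∈S)  = x∈p∪q⁺ (inj₁ x∈S)
∈-⋃⁺ (there any) = x∈p∪q⁺ (inj₂ (∈-⋃⁺ any))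

∈-⋃⁻ : ∀ {x : Fin n} Ss → x ∈ ⋃ Ss → Any (x ∈_) Ss
∈-⋃⁻ []       x∈ = contradiction x∈ ∉⊥
∈-⋃⁻ (S ∷ Ss) x∈ with x∈p∪q⁻ S (⋃ Ss) x∈
... | inj₁ x∈S  = here x∈S
... | inj₂ x∈Ss = there (∈-⋃⁻ Ss x∈Ss)

∈-subsets : (S : Subset n) → S ListMem.∈ subsets n
∈-subsets Vec.[] = here refl
∈-subsets (outside Vec.∷ S) = ∈-++⁺ˡ (∈-map⁺ _ (∈-subsets S))
∈-subsets (inside Vec.∷ S) = ∈-++⁺ʳ (List.map _ (subsets _)) (∈-map⁺ _ (∈-subsets S))

min-map≤ : ∀ {A : Set} (f : A → ℕ) b {xs x} → x ListMem.∈ xs → min b (List.map f xs) ≤ f x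
min-map≤ f b {xs} x∈xs = min≤v⁺ b (List.map f xs) (inj₂ (Anyₚ.map⁺ (Any.map (λ { refl → ≤-refl }) x∈xs)))

min-map-attained : ∀ {A : Set} (f : A → ℕ) b {xs x} → x ListMem.∈ xs → f x ≤ b →
  ∃ λ y → y ListMem.∈ xs × f y ≡ min b (List.map f xs)
min-map-attained f b {xs} {x} x∈xs fx≤b with argmin-sel (λ y → y) b (List.map f xs)
... | inj₂ v∈ = let y , y∈xs , eq = ∈-map⁻ f v∈ in y , y∈xs , sym eq
-- The minimum is the default `b`; since `f x ≤ b`, the element `x` attains it.
... | inj₁ eq = x , x∈xs , ℕₚ.≤-antisym (≤-trans fx≤b (≤-reflexive (sym eq))) (min-map≤ f b x∈xs)

module _ {n} (G : Graph n) where
  open Graph G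

  Near : Fin n → Fin n → Set
  Near v x = x ≡ v ⊎ v ~ x

  near? : ∀ v x → Dec (Near v x)
  near? v x = x ≟ v ⊎-dec v ~? x

  Near-sym : ∀ {v x} → Near v x → Near x v
  Near-sym = Sum.map sym ~-sym

  dominates⁺ : ∀ {S} → (∀ x → ∃ λ v → v ∈ S × Near v x) → Dominates G S
  dominates⁺ {S} dom = ⊆-antisym ⊆⊤ λ {x} _ →
    let v , v∈S , near = dom x in
    ∈-⋃⁺ (Anyₚ.map⁺ (Any.map (λ { refl → ∈-select⁺ (near? v) near })
      (∈-filter⁺ (_∈? S) (∈-allFin v) v∈S)))

  dominates⁻ : ∀ {S} → Dominates G S → ∀ x → ∃ λ v → v ∈ S × Near v x
  dominates⁻ {S} dom x =
    let v , v∈ , x∈N[v] = ListMem.find (Anyₚ.map⁻ (∈-⋃⁻ (List.map N[ G ] _) (subst (x ∈_) (sym dom) ∈⊤))) in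
    v , proj₂ (∈-filter⁻ (_∈? S) {xs = allFin n} v∈) , ∈-select⁻ (near? v) x∈N[v]

  γ≤ : {P : Fin n → Set} (P? : ∀ v → Dec (P v)) → (∀ x → ∃ λ v → P v × Near v x) →
    γ G ≤ ∑[ v < n ] 𝟙 (P? v)
  γ≤ P? dom = ≤-trans
    (min-map≤ ∣_∣ n (∈-filter⁺ (dominates? G) (∈-subsets (select P?))
      (dominates⁺ λ x → let v , p , near = dom x in v , ∈-select⁺ P? p , near)))
    (≤-reflexive (∣select∣ P?))

  γSet : ∃ (IsγSet G)
  γSet =
    -- The full set dominates and has at most `n` elements, so even the default `n` of `min` is
    -- attained by a dominating set.
    let S , S∈ , eq = min-map-attained ∣_∣ n
          (∈-filter⁺ (dominates? G) (∈-subsets ⊤) (dominates⁺ λ x → x , ∈⊤ , inj₁ refl)) (∣p∣≤n ⊤)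
    in S , proj₂ (∈-filter⁻ (dominates? G) {xs = subsets n} S∈) , eq

  allegiance≤n : ∀ S → allegiance G S ≤ n
  allegiance≤n S = max≤v⁺ z≤n (Allₚ.map⁺ (All.universal (λ v → ∣p∣≤n (S ∩ N[ G ] v)) (allFin n)))

  ∣S∩N[v]∣≤allegiance : ∀ S v → ∣ S ∩ N[ G ] v ∣ ≤ allegiance G S
  ∣S∩N[v]∣≤allegiance S v = All.lookup (xs≤max 0 _) (∈-map⁺ (λ v → ∣ S ∩ N[ G ] v ∣) (∈-allFin v))

  π-attained : ∃ λ S → IsγSet G S × allegiance G S ≡ π G
  π-attained =
    let S₀ , isγ = γSet
        S , S∈ , eq = min-map-attained (allegiance G) n
          (∈-filter⁺ (isγSet? G) (∈-subsets S₀) isγ) (allegiance≤n S₀)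
    in S , proj₂ (∈-filter⁻ (isγSet? G) {xs = subsets n} S∈) , eq

-- A dominator of `combine x h` shares its row or its column. Equality goes to the first
-- alternative, so in the second the row `h′` differs from `h`.
□-dominates : (G : Graph m) (H : Graph n) {D : Subset (m *ℕ n)} → Dominates (G □ H) D → ∀ x h →
  (∃ λ g → combine g h ∈ D × Near G g x) ⊎ (∃ λ h′ → combine x h′ ∈ D × Graph._~_ H h′ h)
□-dominates {m} {n} G H dom x h
  with v , v∈D , near ← dominates⁻ (G □ H) dom (combine x h)
  with near
... | inj₁ refl = inj₁ (x , v∈D , inj₁ refl)
... | inj₂ v~
  with g , h′ , refl ← combine-surjective {m} {n} v
  with subst₂ (CartesianAdj G H) (remQuot-combine g h′) (remQuot-combine x h) v~
... | inj₁ (refl , g~x) = inj₁ (g , v∈D , inj₂ g~x)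
... | inj₂ (refl , h′~h) = inj₂ (h′ , v∈D , h′~h)

-- Labels, colourings and uncovered pairs

module _ (G : Graph m) (H : Graph n) {D : Subset (m *ℕ n)} (D-dom : Dominates (G □ H) D)
  {Γ : Subset m} (Γ-γ : IsγSet G Γ) {q} (Γ-all : allegiance G Γ ≡ suc q) where

  private
    module G = Graph G
    module H = Graph H

    Neighbour : Fin m → Fin m → Set
    Neighbour g u = u ∈ Γ × Near G g u

    neighbour? : ∀ g u → Dec (Neighbour g u)
    neighbour? g u = u ∈? Γ ×-dec near? G g u

    ∣Γ∩N[g]∣≤ : ∀ g → ∣ Γ ∩ N[_] G g ∣ ≤ suc q
    ∣Γ∩N[g]∣≤ g = ≤-trans (∣S∩N[v]∣≤allegiance G Γ g) (≤-reflexive Γ-all)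

    sum-neighbours≤ : ∀ g → ∑[ u < m ] 𝟙 (neighbour? g u) ≤ suc q
    sum-neighbours≤ g = ≤-trans (sum-mono-≤ λ u → 𝟙-mono (neighbour? g u) (u ∈? Γ ∩ N[_] G g)
        λ (u∈Γ , near) → x∈p∩q⁺ (u∈Γ , ∈-select⁺ (near? G g) near))
      (≤-trans (≤-reflexive (sym ∣ Γ ∩ N[_] G g ∣≡sum)) (∣Γ∩N[g]∣≤ g))

    -- A vertex of Γ always labels itself; every other vertex takes all its
    -- neighbours in Γ as labels when the colour runs through Fin (suc q).
    labelling : ∀ g → Σ[ f ∈ (Fin (suc q) → Fin m) ] (∀ c → Neighbour g (f c)) ×
      (g ∈ Γ → ∀ c → f c ≡ g) × (g ∉ Γ → ∀ {u} → Neighbour g u → ∃ λ c → f c ≡ u)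
    labelling g with g ∈? Γ
    ... | yes g∈Γ = (λ _ → g) , (λ _ → g∈Γ , inj₁ refl) , (λ _ _ → refl) , λ g∉Γ → contradiction g∈Γ g∉Γ
    ... | no g∉Γ =
      -- `enumerate` needs an element of `Γ ∩ N[g]`; one exists because `Γ` dominates `g`.
      let u , u∈Γ , near = dominates⁻ G (proj₁ Γ-γ) g
          member : ∀ {u} → Neighbour g u → u ∈ Γ ∩ N[_] G g
          member (u∈Γ , near) = x∈p∩q⁺ (u∈Γ , ∈-select⁺ (near? G g) near)
          f , f∈ , onto = enumerate (suc q) (Γ ∩ N[_] G g) (∣Γ∩N[g]∣≤ g) (member (u∈Γ , Near-sym G near))
          neighbour : ∀ c → Neighbour g (f c)
          neighbour c = let f∈Γ , f∈N = x∈p∩q⁻ Γ _ (f∈ c) in f∈Γ , ∈-select⁻ (near? G g) f∈N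
      in f , neighbour , (λ g∈Γ → contradiction g∈Γ g∉Γ) , λ _ nb → onto (member nb)

    label : Fin (suc q) → Fin m → Fin m
    label c g = proj₁ (labelling g) c

    label-neighbour : ∀ c g → Neighbour g (label c g)
    label-neighbour c g = proj₁ (proj₂ (labelling g)) c

    label-fixes-Γ : ∀ c {g} → g ∈ Γ → label c g ≡ g
    label-fixes-Γ c {g} g∈Γ = proj₁ (proj₂ (proj₂ (labelling g))) g∈Γ c

    label-onto : ∀ {g u} → g ∉ Γ → Neighbour g u → ∃ λ c → label c g ≡ u
    label-onto {g} g∉Γ nb = proj₂ (proj₂ (proj₂ (labelling g))) g∉Γ nb

    Colouring : Set
    Colouring = Vec (Fin (suc q)) n

    InRow : Fin n → Fin m → Set
    InRow h g = combine g h ∈ D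

    inRow? : ∀ h g → Dec (InRow h g)
    inRow? h g = combine g h ∈? D

    row : Fin n → ℕ
    row h = ∑[ g < m ] 𝟙 (inRow? h g)

    Labelled : Colouring → Fin n → Fin m → Set
    Labelled κ h u = ∃ λ g → InRow h g × label (lookup κ h) g ≡ u

    labelled? : ∀ κ h u → Dec (Labelled κ h u)
    labelled? κ h u = any? λ g → inRow? h g ×-dec label (lookup κ h) g ≟ u

    Uncovered : Colouring → Fin n → Fin m → Set
    Uncovered κ h u = u ∈ Γ × ¬ (∃ λ h′ → Near H h′ h × Labelled κ h′ u)

    uncovered? : ∀ κ h u → Dec (Uncovered κ h u)
    uncovered? κ h u = u ∈? Γ ×-dec ¬? (any? λ h′ → near? H h′ h ×-dec labelled? κ h′ u)

    -- Each vertex of the row has a single label. Equality with that label is relaxed to membership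
    -- in a singleton, whose indicator sums to 1.
    sum-labelled≤row : ∀ κ h → ∑[ u < m ] 𝟙 (labelled? κ h u) ≤ row h
    sum-labelled≤row κ h = begin
      sum (λ u → 𝟙 (labelled? κ h u))
        ≤⟨ sum-mono-≤ (λ u → 𝟙≤sum (labelled? κ h u) (λ g → inRow? h g ×-dec u ∈? ⁅ ℓ g ⁆)
             λ { (g , g∈D , refl) → g , g∈D , x∈⁅x⁆ _ }) ⟩
      sum (λ u → sum λ g → 𝟙 (inRow? h g ×-dec u ∈? ⁅ ℓ g ⁆))
        ≡⟨ ∑-comm (λ u g → 𝟙 (inRow? h g ×-dec u ∈? ⁅ ℓ g ⁆)) ⟩
      sum (λ g → sum λ u → 𝟙 (inRow? h g ×-dec u ∈? ⁅ ℓ g ⁆))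
        ≡⟨ sum-cong-≗ (λ g → sum-𝟙-× (inRow? h g) (λ u → u ∈? ⁅ ℓ g ⁆)) ⟩
      sum (λ g → 𝟙 (inRow? h g) *ℕ sum λ u → 𝟙 (u ∈? ⁅ ℓ g ⁆))
        ≡⟨ sum-cong-≗ (λ g → trans (cong (𝟙 (inRow? h g) *ℕ_) (sum-singleton (ℓ g))) (ℕₚ.*-identityʳ _)) ⟩
      row h ∎
      where
      open ℕₚ.≤-Reasoning
      ℓ = label (lookup κ h)

    -- For u ∈ Γ, the rows in which u is a label or is uncovered dominate H.
    γγ≤ : ∀ κ → γ G *ℕ γ H ≤ ∑[ h < n ] row h + ∑[ h < n ] ∑[ u < m ] 𝟙 (uncovered? κ h u)
    γγ≤ κ = begin
      γ G *ℕ γ H                               ≡⟨ cong (_*ℕ γ H) (trans (sym (proj₂ Γ-γ)) ∣ Γ ∣≡sum) ⟩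
      sum (λ u → 𝟙 (u ∈? Γ)) *ℕ γ H            ≡⟨ *-distribʳ-sum (γ H) (λ u → 𝟙 (u ∈? Γ)) ⟩
      sum (λ u → 𝟙 (u ∈? Γ) *ℕ γ H)            ≤⟨ sum-mono-≤ (λ u → fibre u (u ∈? Γ)) ⟩
      sum (λ u → sum λ h → L h u + U h u)      ≡⟨ ∑-comm (λ u h → L h u + U h u) ⟩
      sum (λ h → sum λ u → L h u + U h u)      ≡⟨ sum-cong-≗ (λ h → ∑-distrib-+ (L h) (U h)) ⟩
      sum (λ h → sum (L h) + sum (U h))        ≡⟨ ∑-distrib-+ (λ h → sum (L h)) (λ h → sum (U h)) ⟩
      sum (λ h → sum (L h)) + sum (λ h → sum (U h))
        ≤⟨ ℕₚ.+-monoˡ-≤ _ (sum-mono-≤ (sum-labelled≤row κ)) ⟩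
      sum row + sum (λ h → sum (U h))          ∎
      where
      open ℕₚ.≤-Reasoning
      L U : Fin n → Fin m → ℕ
      L h u = 𝟙 (labelled? κ h u)
      U h u = 𝟙 (uncovered? κ h u)

      dom : ∀ {u} → u ∈ Γ → ∀ h → ∃ λ h′ → (Labelled κ h′ u ⊎ Uncovered κ h′ u) × Near H h′ h
      dom {u} u∈Γ h with any? (λ h′ → near? H h′ h ×-dec labelled? κ h′ u)
      ... | yes (h′ , near , lab) = h′ , inj₁ lab , near
      ... | no ¬cov               = h , inj₂ (u∈Γ , ¬cov) , inj₁ refl

      fibre : ∀ u (u∈Γ? : Dec (u ∈ Γ)) → 𝟙 u∈Γ? *ℕ γ H ≤ sum λ h → L h u + U h u
      fibre u (no _)    = z≤n
      fibre u (yes u∈Γ) = begin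
        γ H + 0  ≡⟨ ℕₚ.+-identityʳ _ ⟩
        γ H      ≤⟨ γ≤ H (λ h → labelled? κ h u ⊎-dec uncovered? κ h u) (dom u∈Γ) ⟩
        sum (λ h → 𝟙 (labelled? κ h u ⊎-dec uncovered? κ h u))
                 ≤⟨ sum-mono-≤ (λ h → 𝟙-⊎ (labelled? κ h u) (uncovered? κ h u)) ⟩
        _ ∎

    -- Only the colour c of row h varies.  An uncovered u is missing, whatever c is.  If
    -- the row has a neighbour g ∉ Γ of a missing u, then u is the label of g for some c,
    -- so u is uncovered for at most q of the suc q colours.  Otherwise u is remote, hence
    -- adjacent to some g ∈ Γ in the row, and each such g has at most q neighbours in Γ.
    module Resample (κ : Colouring) (h : Fin n) where

      -- Adjacency keeps `h′` different from `h`, so this does not depend on the colour of row `h`.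
      CoveredFromOutside : Fin m → Set
      CoveredFromOutside u = ∃ λ h′ → h′ H.~ h × Labelled κ h′ u

      coveredFromOutside? : ∀ u → Dec (CoveredFromOutside u)
      coveredFromOutside? u = any? λ h′ → h′ H.~? h ×-dec labelled? κ h′ u

      Missing : Fin m → Set
      Missing u = u ∈ Γ × ¬ CoveredFromOutside u × ¬ InRow h u

      missing? : ∀ u → Dec (Missing u)
      missing? u = u ∈? Γ ×-dec ¬? (coveredFromOutside? u) ×-dec ¬? (inRow? h u)

      HasLabeller : Fin m → Set
      HasLabeller u = ∃ λ g → InRow h g × g ∉ Γ × Near G g u

      hasLabeller? : ∀ u → Dec (HasLabeller u)
      hasLabeller? u = any? λ g → inRow? h g ×-dec ¬? (g ∈? Γ) ×-dec near? G g u

      Remote : Fin m → Set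
      Remote u = Missing u × ¬ HasLabeller u

      remote? : ∀ u → Dec (Remote u)
      remote? u = missing? u ×-dec ¬? (hasLabeller? u)

      inside? : ∀ g → Dec (InRow h g × g ∈ Γ)
      inside? g = inRow? h g ×-dec g ∈? Γ

      outside? : ∀ g → Dec (InRow h g × g ∉ Γ)
      outside? g = inRow? h g ×-dec ¬? (g ∈? Γ)

      -- The vertices of the row together with the u ∈ Γ covered from outside
      -- dominate G, so they are at least as many as Γ.
      sum-missing≤outside : ∑[ u < m ] 𝟙 (missing? u) ≤ ∑[ g < m ] 𝟙 (outside? g)
      sum-missing≤outside = ℕₚ.+-cancelˡ-≤ (sum γs) _ _ $ begin
        sum γs + sum (λ u → 𝟙 (missing? u))   ≡⟨ cong (_+ sum (λ u → 𝟙 (missing? u))) (trans (sym ∣ Γ ∣≡sum) (proj₂ Γ-γ)) ⟩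
        γ G + sum (λ u → 𝟙 (missing? u))      ≤⟨ ℕₚ.+-monoˡ-≤ _ (γ≤ G x? dom) ⟩
        sum (λ u → 𝟙 (x? u)) + sum (λ u → 𝟙 (missing? u))
                                              ≡⟨ ∑-distrib-+ (λ u → 𝟙 (x? u)) (λ u → 𝟙 (missing? u)) ⟨
        sum (λ u → 𝟙 (x? u) + 𝟙 (missing? u))
          ≤⟨ sum-mono-≤ (λ u → 𝟙-exchange (inRow? h u) (u ∈? Γ) (coveredFromOutside? u)) ⟩
        sum (λ u → γs u + 𝟙 (outside? u))     ≡⟨ ∑-distrib-+ γs (λ u → 𝟙 (outside? u)) ⟩
        sum γs + sum (λ u → 𝟙 (outside? u))   ∎
        where
        open ℕₚ.≤-Reasoning
        γs : Fin m → ℕ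
        γs u = 𝟙 (u ∈? Γ)

        x? : ∀ u → Dec (InRow h u ⊎ (u ∈ Γ × CoveredFromOutside u))
        x? u = inRow? h u ⊎-dec (u ∈? Γ ×-dec coveredFromOutside? u)

        dom : ∀ x → ∃ λ u → (InRow h u ⊎ (u ∈ Γ × CoveredFromOutside u)) × Near G u x
        dom x with □-dominates G H D-dom x h
        ... | inj₁ (g , g∈D , near)  = g , inj₁ g∈D , near
        -- The vertex `(x , h′)` of `D` has a label in `Γ ∩ N[x]`; that label is covered from
        -- outside and dominates `x`.
        ... | inj₂ (h′ , x∈D , h′~h) =
          let u∈Γ , near = label-neighbour (lookup κ h′) x in
          label (lookup κ h′) x , inj₂ (u∈Γ , h′ , h′~h , x , x∈D , refl) , Near-sym G near

      -- Recolouring row `h` leaves the labels in adjacent rows unchanged, and an element of `Γ`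
      -- lying in the row is its own label under every colour.
      uncovered⇒missing : ∀ c {u} → Uncovered (κ [ h ]≔ c) h u → Missing u
      uncovered⇒missing c {u} (u∈Γ , ¬cov) = u∈Γ
        , (λ (h′ , h′~h , g , g∈D , eq) → ¬cov (h′ , inj₂ h′~h , g , g∈D ,
            trans (cong (λ c → label c g) (lookup∘update′ (λ { refl → H.~-irref h′~h }) κ c)) eq))
        , λ u∈D → ¬cov (h , inj₁ refl , u , u∈D , label-fixes-Γ _ u∈Γ)

      sum-uncovered≤ : ∀ u → ∑[ c < suc q ] 𝟙 (uncovered? (κ [ h ]≔ c) h u) ≤ q *ℕ 𝟙 (missing? u) + 𝟙 (remote? u)
      sum-uncovered≤ u = by-cases (missing? u) (hasLabeller? u)
        where
        open ℕₚ.≤-Reasoning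
        U? = λ c → uncovered? (κ [ h ]≔ c) h u
        by-cases : (M? : Dec (Missing u)) (L? : Dec (HasLabeller u)) →
          sum (𝟙 ∘ U?) ≤ q *ℕ 𝟙 M? + 𝟙 (M? ×-dec ¬? L?)
        by-cases (no ¬mis) _ = begin
          sum (𝟙 ∘ U?)     ≤⟨ sum-mono-≤ (λ c → 𝟙-mono (U? c) (no ¬mis) (uncovered⇒missing c)) ⟩
          sum {suc q} (λ _ → 0)    ≡⟨ sum-const (suc q) 0 ⟩
          suc q *ℕ 0       ≡⟨ ℕₚ.*-zeroʳ q ⟩
          0                ≤⟨ z≤n ⟩
          _                ∎
        -- Here `u` is remote and all `suc q` colours may fail: `q` of them are charged to
        -- `missing?` and one to `remote?`.
        by-cases (yes _) (no _) = begin
          sum (𝟙 ∘ U?)     ≤⟨ sum-𝟙≤ U? ⟩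
          suc q            ≡⟨ ℕₚ.+-comm 1 q ⟩
          q + 1            ≡⟨ cong (_+ 1) (ℕₚ.*-identityʳ q) ⟨
          q *ℕ 1 + 1       ∎
        by-cases (yes (u∈Γ , _)) (yes (g , g∈D , g∉Γ , near)) with c , eq ← label-onto g∉Γ (u∈Γ , near) = begin
          sum (𝟙 ∘ U?)     ≤⟨ sum-𝟙< U? c (λ (_ , ¬cov) → ¬cov (h , inj₁ refl , g , g∈D ,
                                trans (cong (λ c → label c g) (lookup∘update h κ c)) eq)) ⟩
          q                ≡⟨ ℕₚ.*-identityʳ q ⟨
          q *ℕ 1           ≡⟨ ℕₚ.+-identityʳ _ ⟨
          q *ℕ 1 + 0       ∎

      ProperNeighbour : Fin m → Fin m → Set
      ProperNeighbour g u = u ∈ Γ × g G.~ u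

      properNeighbour? : ∀ g u → Dec (ProperNeighbour g u)
      properNeighbour? g u = u ∈? Γ ×-dec g G.~? u

      -- Consider what dominates `(u , h)`. A dominator in another row would label itself `u` and
      -- cover `u` from outside; `u` itself is not in the row; a dominator `g ∉ Γ` would be a
      -- labeller. Only an adjacent `g ∈ Γ` in the row remains.
      remote⇒neighbour : ∀ {u} → Remote u → ∃ λ g → (InRow h g × g ∈ Γ) × ProperNeighbour g u
      remote⇒neighbour {u} ((u∈Γ , ¬cov , u∉D) , ¬lab) with □-dominates G H D-dom u h
      ... | inj₂ (h′ , u∈D , h′~h)       = contradiction (h′ , h′~h , u , u∈D , label-fixes-Γ _ u∈Γ) ¬cov
      ... | inj₁ (g , g∈D , inj₁ refl)   = contradiction g∈D u∉D
      ... | inj₁ (g , g∈D , inj₂ g~u) with g ∈? Γ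
      ...   | yes g∈Γ = g , (g∈D , g∈Γ) , u∈Γ , g~u
      ...   | no g∉Γ  = contradiction (g , g∈D , g∉Γ , inj₂ g~u) ¬lab

      -- Since `g ∈ Γ`, the vertex `g` takes up one of the at most `suc q` places in `Γ ∩ N[g]`.
      sum-properNeighbours≤ : ∀ {g} → g ∈ Γ → ∑[ u < m ] 𝟙 (properNeighbour? g u) ≤ q
      sum-properNeighbours≤ {g} g∈Γ = s≤s⁻¹ $ begin
        1 + sum (λ u → 𝟙 (properNeighbour? g u))
          ≡⟨ cong (_+ sum (λ u → 𝟙 (properNeighbour? g u))) (sum-singleton g) ⟨
        sum (λ u → 𝟙 (u ∈? ⁅ g ⁆)) + sum (λ u → 𝟙 (properNeighbour? g u))
          ≡⟨ ∑-distrib-+ (λ u → 𝟙 (u ∈? ⁅ g ⁆)) (λ u → 𝟙 (properNeighbour? g u)) ⟨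
        sum (λ u → 𝟙 (u ∈? ⁅ g ⁆) + 𝟙 (properNeighbour? g u))
          ≤⟨ sum-mono-≤ disjoint ⟩
        sum (λ u → 𝟙 (neighbour? g u))
          ≤⟨ sum-neighbours≤ g ⟩
        suc q ∎
        where
        open ℕₚ.≤-Reasoning
        disjoint : ∀ u → 𝟙 (u ∈? ⁅ g ⁆) + 𝟙 (properNeighbour? g u) ≤ 𝟙 (neighbour? g u)
        disjoint u with u ∈? ⁅ g ⁆
        ... | no _ = 𝟙-mono (properNeighbour? g u) (neighbour? g u) λ (u∈Γ , g~u) → u∈Γ , inj₂ g~u
        -- At `u = g` the second indicator vanishes by irreflexivity.
        ... | yes u∈ with refl ← x∈⁅y⁆⇒x≡y g u∈ = begin
          1 + 𝟙 (properNeighbour? g g)  ≤⟨ s≤s (𝟙-mono (properNeighbour? g g) (no (λ x → x)) (G.~-irref ∘ proj₂)) ⟩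
          1                             ≡⟨ 𝟙-true (neighbour? g g) (g∈Γ , inj₁ refl) ⟨
          𝟙 (neighbour? g g)            ∎

      sum-remote≤ : ∑[ u < m ] 𝟙 (remote? u) ≤ q *ℕ ∑[ g < m ] 𝟙 (inside? g)
      sum-remote≤ = begin
        sum (λ u → 𝟙 (remote? u))
          ≤⟨ sum-mono-≤ (λ u → 𝟙≤sum (remote? u) (λ g → inside? g ×-dec properNeighbour? g u) remote⇒neighbour) ⟩
        sum (λ u → sum λ g → 𝟙 (inside? g ×-dec properNeighbour? g u))
          ≡⟨ ∑-comm (λ u g → 𝟙 (inside? g ×-dec properNeighbour? g u)) ⟩
        sum (λ g → sum λ u → 𝟙 (inside? g ×-dec properNeighbour? g u))
          ≡⟨ sum-cong-≗ (λ g → sum-𝟙-× (inside? g) (properNeighbour? g)) ⟩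
        sum (λ g → 𝟙 (inside? g) *ℕ sum λ u → 𝟙 (properNeighbour? g u))
          ≤⟨ sum-mono-≤ (λ g → bound g (inside? g)) ⟩
        sum (λ g → q *ℕ 𝟙 (inside? g))
          ≡⟨ *-distribˡ-sum q (λ g → 𝟙 (inside? g)) ⟨
        q *ℕ sum (λ g → 𝟙 (inside? g)) ∎
        where
        open ℕₚ.≤-Reasoning
        bound : ∀ g (I? : Dec (InRow h g × g ∈ Γ)) →
          𝟙 I? *ℕ sum (λ u → 𝟙 (properNeighbour? g u)) ≤ q *ℕ 𝟙 I?
        bound g (no _)          = z≤n
        bound g (yes (_ , g∈Γ)) = begin
          _ + 0   ≡⟨ ℕₚ.+-identityʳ _ ⟩
          _       ≤⟨ sum-properNeighbours≤ g∈Γ ⟩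
          q       ≡⟨ ℕₚ.*-identityʳ q ⟨
          q *ℕ 1  ∎

      -- Each missing vertex costs `q`, and there are at most as many of them as row vertices
      -- outside `Γ`. Each remote vertex costs one more, and there are at most `q` of them per row
      -- vertex inside `Γ`. The two kinds of row vertices make up the row.
      resample≤ : ∑[ c < suc q ] ∑[ u < m ] 𝟙 (uncovered? (κ [ h ]≔ c) h u) ≤ q *ℕ row h
      resample≤ = begin
        sum (λ c → sum λ u → 𝟙 (uncovered? (κ [ h ]≔ c) h u))
          ≡⟨ ∑-comm (λ c u → 𝟙 (uncovered? (κ [ h ]≔ c) h u)) ⟩
        sum (λ u → sum λ c → 𝟙 (uncovered? (κ [ h ]≔ c) h u))
          ≤⟨ sum-mono-≤ sum-uncovered≤ ⟩
        sum (λ u → q *ℕ 𝟙 (missing? u) + 𝟙 (remote? u))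
          ≡⟨ ∑-distrib-+ (λ u → q *ℕ 𝟙 (missing? u)) (λ u → 𝟙 (remote? u)) ⟩
        sum (λ u → q *ℕ 𝟙 (missing? u)) + sum (λ u → 𝟙 (remote? u))
          ≡⟨ cong (_+ sum (λ u → 𝟙 (remote? u))) (*-distribˡ-sum q (λ u → 𝟙 (missing? u))) ⟨
        q *ℕ sum (λ u → 𝟙 (missing? u)) + sum (λ u → 𝟙 (remote? u))
          ≤⟨ +-mono-≤ (ℕₚ.*-monoʳ-≤ q sum-missing≤outside) sum-remote≤ ⟩
        q *ℕ sum (λ g → 𝟙 (outside? g)) + q *ℕ sum (λ g → 𝟙 (inside? g))
          ≡⟨ ℕₚ.*-distribˡ-+ q _ _ ⟨
        q *ℕ (sum (λ g → 𝟙 (outside? g)) + sum (λ g → 𝟙 (inside? g)))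
          ≡⟨ cong (q *ℕ_) (∑-distrib-+ (λ g → 𝟙 (outside? g)) (λ g → 𝟙 (inside? g))) ⟨
        q *ℕ sum (λ g → 𝟙 (outside? g) + 𝟙 (inside? g))
          ≡⟨ cong (q *ℕ_) (sum-cong-≗ λ g → 𝟙-split (inRow? h g) (g ∈? Γ)) ⟨
        q *ℕ row h ∎
        where open ℕₚ.≤-Reasoning

    sum-rows : ∑[ h < n ] row h ≡ ∣ D ∣
    sum-rows = begin
      sum (λ h → sum λ g → 𝟙 (inRow? h g))  ≡⟨ ∑-comm (λ h g → 𝟙 (inRow? h g)) ⟩
      sum (λ g → sum λ h → 𝟙 (inRow? h g))  ≡⟨ sum-combine m n (λ v → 𝟙 (v ∈? D)) ⟨
      sum (λ v → 𝟙 (v ∈? D))                      ≡⟨ ∣ D ∣≡sum ⟨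
      ∣ D ∣                                       ∎
      where open ≡-Reasoning

  -- `average` is applied to the number of uncovered pairs in each row, with `q *ℕ row h` as the
  -- resampling bound. The factor `2 - 1/p` appears multiplied through by `p = suc q`.
  allegiance-bound : suc q *ℕ (γ G *ℕ γ H) ≤ suc q *ℕ ∣ D ∣ + q *ℕ ∣ D ∣
  allegiance-bound = subst (λ d → suc q *ℕ (γ G *ℕ γ H) ≤ suc q *ℕ d + q *ℕ d) sum-rows $
    ≤-trans (average q n (λ h κ → ∑[ u < m ] 𝟙 (uncovered? κ h u)) (λ h → q *ℕ row h)
              (λ h κ → Resample.resample≤ κ h) γγ≤)
            (≤-reflexive (cong (suc q *ℕ sum row +_) (sym (*-distribˡ-sum q row))))

-- The inequality over the naturals and its rational form

γγ-bound : .{{_ : NonZero m}} (G : Graph m) (H : Graph n) →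
  π G *ℕ (γ G *ℕ γ H) ≤ γ (G □ H) *ℕ (2 *ℕ π G ∸ 1)
-- `1≤π G` excludes zero, so the allegiance has the form `suc q`.
γγ-bound G H with π G | 1≤π G | π-attained G | γSet (G □ H)
... | suc q | _ | Γ , Γ-γ , Γ-all | D , D-dom , ∣D∣≡γ =
  ≤-trans (allegiance-bound G H D-dom Γ-γ Γ-all) (≤-reflexive (trans (arith q ∣ D ∣) (cong (_*ℕ _) ∣D∣≡γ)))
  where
  -- The last factor is the normal form of `2 *ℕ suc q ∸ 1`.
  arith : ∀ q d → d + q *ℕ d + q *ℕ d ≡ d *ℕ (q + suc (q + 0))
  arith = solve-∀

-- Opened only here because +_ makes sections of _+_ ambiguous.
open import Data.Integer.Base using (+_)

-- Among unnormalised rationals no fraction is reduced, so after transfer the inequality is plain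
-- cross-multiplication.
/-*-≤ : ∀ p k .{{_ : NonZero k}} a b d → p *ℕ (a *ℕ b) ≤ d *ℕ k → (+ p / k) * (+ a / 1) * (+ b / 1) ℚ.≤ + d / 1
/-*-≤ p (suc k) a b d pab≤dk = toℚᵘ-cancel-≤ $ begin
  ℚ.toℚᵘ ((+ p / suc k) * (+ a / 1) * (+ b / 1))
    ≃⟨ toℚᵘ-homo-* ((+ p / suc k) * (+ a / 1)) (+ b / 1) ⟩
  ℚ.toℚᵘ ((+ p / suc k) * (+ a / 1)) ℚᵘ.* ℚ.toℚᵘ (+ b / 1)
    ≃⟨ ℚᵘₚ.*-cong (toℚᵘ-homo-* (+ p / suc k) (+ a / 1)) (toℚᵘ-fromℚᵘ (ℚᵘ.mkℚᵘ (+ b) 0)) ⟩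
  ℚ.toℚᵘ (+ p / suc k) ℚᵘ.* ℚ.toℚᵘ (+ a / 1) ℚᵘ.* ℚᵘ.mkℚᵘ (+ b) 0
    ≃⟨ ℚᵘₚ.*-congʳ (ℚᵘₚ.*-cong (toℚᵘ-fromℚᵘ (ℚᵘ.mkℚᵘ (+ p) k)) (toℚᵘ-fromℚᵘ (ℚᵘ.mkℚᵘ (+ a) 0))) ⟩
  ℚᵘ.mkℚᵘ (+ p) k ℚᵘ.* ℚᵘ.mkℚᵘ (+ a) 0 ℚᵘ.* ℚᵘ.mkℚᵘ (+ b) 0
    ≤⟨ ℚᵘ.*≤* cross ⟩
  ℚᵘ.mkℚᵘ (+ d) 0
    ≃⟨ toℚᵘ-fromℚᵘ (ℚᵘ.mkℚᵘ (+ d) 0) ⟨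
  ℚ.toℚᵘ (+ d / 1) ∎
  where
  open ℚᵘₚ.≤-Reasoning
  cross : + p ℤ.* + a ℤ.* + b ℤ.* + 1 ℤ.≤ + d ℤ.* + (suc k *ℕ 1 *ℕ 1)
  -- Integer products become casts of natural ones, and the unit denominators drop out.
  cross rewrite sym (ℤₚ.pos-* p a) | sym (ℤₚ.pos-* (p *ℕ a) b) | ℤₚ.*-identityʳ (+ (p *ℕ a *ℕ b))
    | ℕₚ.*-identityʳ (k *ℕ 1) | ℕₚ.*-identityʳ k | sym (ℤₚ.pos-* d (suc k)) | ℕₚ.*-assoc p a b = ℤ.+≤+ pab≤dk

theorem2p1 : {m n : ℕ} .{{_ : NonZero m}} .{{_ : NonZero n}} (G : Graph m) (H : Graph n) →
    Connected G → Connected H →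
    + γ (G □ H) / 1 ≥ (+ π G / (2 *ℕ π G ∸ 1)) {{2π∸1-nonZero G}} * (+ γ G / 1) * (+ γ H / 1)
theorem2p1 G H _ _ =
  /-*-≤ (π G) (2 *ℕ π G ∸ 1) {{2π∸1-nonZero G}} (γ G) (γ H) (γ (G □ H)) (γγ-bound G H)
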